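{- For every integer $n\ge 1$, the zigzag map $\zeta^{\mathrm{alt}}:\mathcal{PT}(n)\to S_n$ on the alternative representation is equal to $\varphi\circ\Phi$; that is, $\zeta^{\mathrm{alt}}(T)=\varphi(\Phi(T))$ for all $T\in\mathcal{PT}(n)$.
   Context: Ferrers diagrams: a Ferrers diagram is a left-justified arrangement of square cells, possibly with empty rows; its length is the number of rows plus the number of columns. The steps of the south-east border are labeled $1,\dots,n$ from north-east to south-west ($n$ the length); a row gets the label of its south step and a column the label of its west step. Equivalently, a diagram of length $n$ is a splitting of $\{1,\dots,n\}$ into row labels and column labels; rows are listed top to bottom in increasing order of label, columns left to right in decreasing order of label, and there is a cell in Row $r$ and Column $c$ exactly when $r<c$. Permutation tableaux: $\mathcal{PT}(n)$ is the set of Ferrers diagrams of length $n$ with a $0,1$-filling of the cells such that (1) each column has at least one $1$; (2) there is no $0$ having both a $1$ above it in the same column and a $1$ to the left of it in the same row. A $0$ is restricted if it has a $1$ above it in the same column; a row is unrestricted if it has no restricted $0$. Alternative representation of $T$: replace each topmost $1$ (topmost $1$ of its column) by $\uparrow$ and each rightmost restricted $0$ (rightmost restricted $0$ of its row) by $\leftarrow$, and erase all other entries. Each column then has exactly one $\uparrow$. The map $\Phi:\mathcal{PT}(n)\to S_n$ (values written as words): start with the word of the labels of the unrestricted rows of $T$ in increasing order. For each column, from the leftmost to the rightmost, say Column $c$: if the $\uparrow$ of Column $c$ is in Row $j$ and $i_1<\cdots<i_r$ are the labels of the rows containing a $\leftarrow$ in Column $c$, insert $i_1,\dots,i_r,c$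 in this order immediately before $j$ in the word. $\Phi(T)$ is the final word, a permutation of $\{1,\dots,n\}$. The map $\varphi$: for a word $w=w_1\cdots w_n$ of distinct integers, $w_i$ is a right-to-left minimum (RL-minimum) if $w_i<w_j$ for all $j>i$. If $w_{i_1},\dots,w_{i_k}$ with $i_1<\cdots<i_k=n$ are the RL-minima, $\varphi(w)$ is the permutation of $\{w_1,\dots,w_n\}$ with cycles $(w_1,\dots,w_{i_1}),(w_{i_1+1},\dots,w_{i_2}),\dots,(w_{i_{k-1}+1},\dots,w_{i_k})$, where a cycle $(a_1,\dots,a_p)$ sends $a_1\mapsto a_2\mapsto\cdots\mapsto a_p\mapsto a_1$. The zigzag map $\zeta^{\mathrm{alt}}$: in the alternative representation of $T$, for each label $i\in\{1,\dots,n\}$ consider the path that enters from the left end of Row $i$ travelling east (if $i$ is a row label) or from the top of Column $i$ travelling south (if $i$ is a column label), and that switches direction between east and south each time it meets a cell containing an arrow ($\uparrow$ or $\leftarrow$), until it exits the diagram through the south-east border, at the right end of a Row $j$ or the bottom of a Column $j$. Then $\zeta^{\mathrm{alt}}(T)$ is the permutation sending $i$ to $j$. -}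

module Defs where

open import Data.Bool.Base using (Bool; true; false; if_then_else_)
import Data.Bool.Properties as Bool
open import Data.Empty using (⊥; ⊥-elim)
open import Data.Fin.Base using (Fin; zero; suc; punchOut; _<_)
open import Data.Fin.Permutation using (Permutation′; permutation)
open import Data.Fin.Properties
  using (_≟_; _<?_; any?; all?; <-cmp; <-irrefl; <-asym;
         punchOut-injective; injective⇒≤)
open import Data.List.Base as List
  using (List; []; _∷_; _++_; _∷ʳ_; _ʳ++_; allFin; concat; filter; foldl; foldr;
         reverse)
open import Data.List.Membership.DecPropositional using () renaming (_∈?_ to mem?)
open import Data.List.Membership.Propositional using (_∈_; _∉_)
open import Data.List.Membership.Propositional.Properties
  using (∈-allFin; ∈-filter⁺; ∈-filter⁻; ∈-++⁺ˡ; ∈-++⁺ʳ; ∈-++⁻; ∈-∃++)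
open import Data.List.Properties
  using (ʳ++-defn; reverse-involutive; filter-++; filter-all; filter-none;
         filter-reject; ++-identityʳ)
open import Data.List.Relation.Binary.Permutation.Propositional
  using (_↭_; ↭-refl; ↭-trans; ↭-sym; ↭⇒↭ₛ; prep)
open import Data.List.Relation.Binary.Permutation.Propositional.Properties
  using (shift; ∈-resp-↭)
import Data.List.Relation.Binary.Permutation.Setoid.Properties as SetoidPerm
open import Data.List.Relation.Unary.All as All using (All; []; _∷_)
import Data.List.Relation.Unary.All.Properties as All
open import Data.List.Relation.Unary.AllPairs as AllPairs using (AllPairs; []; _∷_)
import Data.List.Relation.Unary.AllPairs.Properties as AllPairs
open import Data.List.Relation.Unary.Any using (here; there)
import Data.List.Relation.Unary.Any.Properties as Any
open import Data.List.Relation.Unary.Unique.Propositional using (Unique)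
import Data.List.Relation.Unary.Unique.Propositional.Properties as Unique
open import Data.Nat.Base as ℕ using (ℕ)
import Data.Nat.Properties as ℕ
open import Data.Product.Base using (∃; Σ-syntax; _×_; _,_; proj₁; proj₂)
open import Data.Sum.Base using (_⊎_; inj₁; inj₂)
open import Data.Vec.Base as Vec using (Vec; []; _∷_; init; last)
import Data.Vec.Properties as Vec
open import Function.Base using (_∘_; id; flip)
open import Function.Definitions using (Injective)
open import Relation.Binary.Definitions using (DecidableEquality; tri<; tri≈; tri>)
open import Relation.Binary.PropositionalEquality
  using (_≡_; _≢_; refl; sym; trans; cong; subst; setoid)
open import Relation.Nullary using (¬_; Dec; yes; no; does; contradiction)
open import Relation.Nullary.Decidable using (map′; _×-dec_; _→-dec_; ¬?; decidable-stable)

private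
  variable
    n : ℕ

-- The labels 1, …, n are represented by the elements 0, …, n - 1 of Fin n.

data Kind : Set where
  row column : Kind

_≟ᵏ_ : DecidableEquality Kind
row    ≟ᵏ row    = yes refl
row    ≟ᵏ column = no λ ()
column ≟ᵏ row    = no λ ()
column ≟ᵏ column = yes refl

record FerrersDiagram (n : ℕ) : Set where
  field
    kind : Fin n → Kind

  Cell : Fin n → Fin n → Set
  Cell r c = kind r ≡ row × kind c ≡ column × r < c

  cell? : ∀ r c → Dec (Cell r c)
  cell? r c = (kind r ≟ᵏ row) ×-dec (kind c ≟ᵏ column) ×-dec (r <? c)

  -- A 0,1-filling of the cells: true is 1, false is 0.
  Filling : Set
  Filling = ∀ r c → .(Cell r c) → Bool

-- Row r′ is above Row r when r′ < r; Column c′ is to the left of Column c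
-- when c < c′.
module Entries (D : FerrersDiagram n) (F : FerrersDiagram.Filling D) where
  open FerrersDiagram D

  One Zero : Fin n → Fin n → Set
  One  r c = Σ[ p ∈ Cell r c ] F r c p ≡ true
  Zero r c = Σ[ p ∈ Cell r c ] F r c p ≡ false

  RestrictedZero : Fin n → Fin n → Set
  RestrictedZero r c = Zero r c × ∃ λ r′ → r′ < r × One r′ c

  UnrestrictedRow : Fin n → Set
  UnrestrictedRow r = kind r ≡ row × (∀ c → ¬ RestrictedZero r c)

  TopmostOne : Fin n → Fin n → Set
  TopmostOne r c = One r c × (∀ r′ → r′ < r → ¬ One r′ c)

  RightmostRestrictedZero : Fin n → Fin n → Set
  RightmostRestrictedZero r c =
    RestrictedZero r c × (∀ c′ → c′ < c → ¬ RestrictedZero r c′)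

  one? : ∀ r c → Dec (One r c)
  one? r c with cell? r c
  ... | yes p = map′ (p ,_) proj₂ (F r c p Bool.≟ true)
  ... | no ¬p = no (¬p ∘ proj₁)

  zero? : ∀ r c → Dec (Zero r c)
  zero? r c with cell? r c
  ... | yes p = map′ (p ,_) proj₂ (F r c p Bool.≟ false)
  ... | no ¬p = no (¬p ∘ proj₁)

  restrictedZero? : ∀ r c → Dec (RestrictedZero r c)
  restrictedZero? r c =
    zero? r c ×-dec any? (λ r′ → (r′ <? r) ×-dec one? r′ c)

  unrestrictedRow? : ∀ r → Dec (UnrestrictedRow r)
  unrestrictedRow? r =
    (kind r ≟ᵏ row) ×-dec all? (λ c → ¬? (restrictedZero? r c))

  topmostOne? : ∀ r c → Dec (TopmostOne r c)
  topmostOne? r c =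
    one? r c ×-dec all? (λ r′ → (r′ <? r) →-dec ¬? (one? r′ c))

  rightmostRestrictedZero? : ∀ r c → Dec (RightmostRestrictedZero r c)
  rightmostRestrictedZero? r c =
    restrictedZero? r c ×-dec all? (λ c′ → (c′ <? c) →-dec ¬? (restrictedZero? r c′))

record PT (n : ℕ) : Set where
  field
    shape   : FerrersDiagram n
    filling : FerrersDiagram.Filling shape

  open FerrersDiagram shape public
  open Entries shape filling public

  field
    column-has-one : ∀ c → kind c ≡ column → ∃ λ r → One r c
    no-zero-below-and-right-of-ones : ∀ {r c r′ c′} →
      r′ < r → One r′ c → c < c′ → One r c′ → ¬ Zero r c

data Mark : Set where
  ↑ ← blank : Mark

_≟ᵐ_ : DecidableEquality Mark
↑     ≟ᵐ ↑     = yes refl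
↑     ≟ᵐ ←     = no λ ()
↑     ≟ᵐ blank = no λ ()
←     ≟ᵐ ↑     = no λ ()
←     ≟ᵐ ←     = yes refl
←     ≟ᵐ blank = no λ ()
blank ≟ᵐ ↑     = no λ ()
blank ≟ᵐ ←     = no λ ()
blank ≟ᵐ blank = yes refl

isArrow : Mark → Bool
isArrow ↑     = true
isArrow ←     = true
isArrow blank = false

markOf : {A B : Set} → Dec A → Dec B → Mark
markOf (yes _) _       = ↑
markOf (no _)  (yes _) = ←
markOf (no _)  (no _)  = blank

-- Positions (r , c) that are not cells carry blank.
alternative : PT n → Fin n → Fin n → Mark
alternative T r c = markOf (topmostOne? r c) (rightmostRestrictedZero? r c)
  where open PT T

record PermWord (n : ℕ) : Set where
  field
    letters  : List (Fin n)
    unique   : Unique letters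
    complete : ∀ i → i ∈ letters

-- The word is returned unchanged when j does not occur in it.
insertBefore : Fin n → List (Fin n) → List (Fin n) → List (Fin n)
insertBefore j xs []      = []
insertBefore j xs (k ∷ w) =
  if does (k ≟ j) then xs ++ k ∷ w else k ∷ insertBefore j xs w

module _ (T : PT n) where
  open PT T

  rowsMarked : Mark → Fin n → List (Fin n)
  rowsMarked m c = filter (λ r → alternative T r c ≟ᵐ m) (allFin n)

  columnsLeftToRight : List (Fin n)
  columnsLeftToRight = filter (λ c → kind c ≟ᵏ column) (reverse (allFin n))

  -- rowsMarked ↑ c has exactly one element, the row j of the ↑ of Column c.
  insertColumn : List (Fin n) → Fin n → List (Fin n)
  insertColumn w c =
    foldr (λ j → insertBefore j (rowsMarked ← c ∷ʳ c)) w (rowsMarked ↑ c)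

  Φ-letters : List (Fin n)
  Φ-letters =
    foldl insertColumn (filter unrestrictedRow? (allFin n)) columnsLeftToRight

cons-to-first : {A : Set} → A → List (List A) → List (List A)
cons-to-first x []       = (x ∷ []) ∷ []
cons-to-first x (b ∷ bs) = (x ∷ b) ∷ bs

-- The word is cut after each right-to-left minimum.
cutAfterRLMinima : List (Fin n) → List (List (Fin n))
cutAfterRLMinima []      = []
cutAfterRLMinima (x ∷ w) =
  if does (All.all? (x <?_) w)
  then (x ∷ []) ∷ cutAfterRLMinima w
  else cons-to-first x (cutAfterRLMinima w)

-- Sends every listed element to the one listed after it, the last one to a,
-- and fixes the elements that are not listed.
successor : Fin n → List (Fin n) → Fin n → Fin n
successor a []          x = x
successor a (b ∷ [])    x = if does (x ≟ b) then a else x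
successor a (b ∷ c ∷ w) x = if does (x ≟ b) then c else successor a (c ∷ w) x

cycle : List (Fin n) → Fin n → Fin n
cycle []      = id
cycle (a ∷ w) = successor a (a ∷ w)

-- The cycles are disjoint, so that the order of composition is immaterial.
φ-function : List (Fin n) → Fin n → Fin n
φ-function w = foldr (λ b f → cycle b ∘ f) id (cutAfterRLMinima w)

below above : Fin n → List (Fin n)
below {n} i = filter (_<? i) (allFin n)
above {n} i = filter (i <?_) (allFin n)

module _ (T : PT n) where
  open PT T

  turnsAt : Fin n → Fin n → Bool
  turnsAt r c = isArrow (alternative T r c)

  -- In Row r heading east, the columns still to be met are those with labels
  -- between r and the label of the last column met, largest first. In Column c
  -- heading south, the rows still to be met are those with labels between the
  -- label of the last row met and c, smallest first. In both cases the vector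
  -- lists all the labels in this range in increasing order; after a turn the
  -- range is the same. Labels in the range that belong to a line parallel to the
  -- path have no effect, the corresponding position being blank. The path leaves
  -- the diagram when the range is empty.
  east south : ∀ {d} → Fin n → Vec (Fin n) d → Fin n

  east r []         = r
  east r xs@(_ ∷ _) =
    if turnsAt r (last xs) then south (last xs) (init xs) else east r (init xs)

  south c []       = c
  south c (r ∷ xs) = if turnsAt r c then east r xs else south c xs

  ζ-function : Fin n → Fin n
  ζ-function i with kind i
  ... | row    = east  i (Vec.fromList (above i))
  ... | column = south i (Vec.fromList (below i))

injective⇒surjective : (f : Fin n → Fin n) → Injective _≡_ _≡_ f →
                       ∀ j → ∃ λ i → f i ≡ j
injective⇒surjective {ℕ.suc n} f inj j with any? (λ i → f i ≟ j)
... | yes p = p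
... | no ¬p = contradiction
  (injective⇒≤ {f = λ i → punchOut (j≢f i)}
    (λ {x} {y} eq → inj (punchOut-injective (j≢f x) (j≢f y) eq)))
  ℕ.1+n≰n
  where
  j≢f : ∀ i → j ≢ f i
  j≢f i eq = ¬p (i , sym eq)

fromInjective : (f : Fin n → Fin n) → Injective _≡_ _≡_ f → Permutation′ n
fromInjective f inj = permutation f g f∘g λ i → inj (f∘g (f i))
  where
  g   = λ j → proj₁ (injective⇒surjective f inj j)
  f∘g = λ j → proj₂ (injective⇒surjective f inj j)

successor-∉ : ∀ a b w {x : Fin n} → x ∉ b ∷ w → successor a (b ∷ w) x ≡ x
successor-∉ a b [] {x} x∉ with x ≟ b
... | yes refl = contradiction (here refl) x∉
... | no _     = refl
successor-∉ a b (c ∷ w) {x} x∉ with x ≟ b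
... | yes refl = contradiction (here refl) x∉
... | no _     = successor-∉ a c w (x∉ ∘ there)

successor-∈ : ∀ a b w {x : Fin n} → x ∈ b ∷ w → successor a (b ∷ w) x ∈ a ∷ w
successor-∈ a b []      {x} x∈ with x ≟ b
... | yes _  = here refl
successor-∈ a b [] {x} (here eq) | no x≢b = contradiction eq x≢b
successor-∈ a b (c ∷ w) {x} x∈ with x ≟ b
... | yes _  = there (here refl)
successor-∈ a b (c ∷ w) {x} (here eq) | no x≢b = contradiction eq x≢b
successor-∈ a b (c ∷ w) {x} (there x∈) | no _ with successor-∈ a c w x∈
... | here eq = here eq
... | there p = there (there p)

successor-injective : ∀ a b w {x y : Fin n} → Unique w → a ∉ w →
  x ∈ b ∷ w → y ∈ b ∷ w → successor a (b ∷ w) x ≡ successor a (b ∷ w) y → x ≡ y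
successor-injective a b [] _ _ (here refl) (here refl) _ = refl
successor-injective a b (c ∷ w) {x} {y} u a∉ x∈ y∈ eq with x ≟ b | y ≟ b
... | yes refl | yes refl = refl
successor-injective a b (c ∷ w) {x} {y} u a∉ x∈ y∈ eq | yes refl | no y≢b = ⊥-elim (lemma y∈)
  where
  lemma : y ∈ b ∷ c ∷ w → ⊥
  lemma (here e) = y≢b e
  lemma (there y∈) with subst (_∈ a ∷ w) (sym eq) (successor-∈ a c w y∈)
  ... | here refl = a∉ (here refl)
  ... | there c∈  = Unique.Unique[x∷xs]⇒x∉xs u c∈
successor-injective a b (c ∷ w) {x} {y} u a∉ x∈ y∈ eq | no x≢b | yes refl = ⊥-elim (lemma x∈)
  where
  lemma : x ∈ b ∷ c ∷ w → ⊥
  lemma (here e) = x≢b e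
  lemma (there x∈) with subst (_∈ a ∷ w) eq (successor-∈ a c w x∈)
  ... | here refl = a∉ (here refl)
  ... | there c∈  = Unique.Unique[x∷xs]⇒x∉xs u c∈
successor-injective a b (c ∷ w) u a∉ (here e) _ eq | no x≢b | no y≢b = contradiction e x≢b
successor-injective a b (c ∷ w) u a∉ (there _) (here e) eq | no x≢b | no y≢b = contradiction e y≢b
successor-injective a b (c ∷ w) (_ ∷ u) a∉ (there x∈) (there y∈) eq | no x≢b | no y≢b =
  successor-injective a c w u (a∉ ∘ there) x∈ y∈ eq

cycle-injective : ∀ {w : List (Fin n)} → Unique w → Injective _≡_ _≡_ (cycle w)
cycle-injective {w = []} _ eq = eq
cycle-injective {w = a ∷ w} u@(_ ∷ u′) {x} {y} eq
  with mem? _≟_ x (a ∷ w) | mem? _≟_ y (a ∷ w)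
... | yes x∈ | yes y∈ =
  successor-injective a a w u′ (Unique.Unique[x∷xs]⇒x∉xs u) x∈ y∈ eq
... | yes x∈ | no y∉ = contradiction
  (subst (_∈ a ∷ w) (trans eq (successor-∉ a a w y∉)) (successor-∈ a a w x∈)) y∉
... | no x∉ | yes y∈ = contradiction
  (subst (_∈ a ∷ w) (trans (sym eq) (successor-∉ a a w x∉)) (successor-∈ a a w y∈)) x∉
... | no x∉ | no y∉ =
  trans (sym (successor-∉ a a w x∉)) (trans eq (successor-∉ a a w y∉))

concat-cons-to-first : ∀ {A : Set} (x : A) bs → concat (cons-to-first x bs) ≡ x ∷ concat bs
concat-cons-to-first x []      = refl
concat-cons-to-first x (_ ∷ _) = refl

concat-cutAfterRLMinima : (w : List (Fin n)) → concat (cutAfterRLMinima w) ≡ w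
concat-cutAfterRLMinima []      = refl
concat-cutAfterRLMinima (x ∷ w) with does (All.all? (x <?_) w)
... | true  = cong (x ∷_) (concat-cutAfterRLMinima w)
... | false = trans (concat-cons-to-first x (cutAfterRLMinima w))
                    (cong (x ∷_) (concat-cutAfterRLMinima w))

++-uniqueˡ : ∀ {A : Set} (xs : List A) {ys} → Unique (xs ++ ys) → Unique xs
++-uniqueˡ []       _       = []
++-uniqueˡ (x ∷ xs) (p ∷ u) = All.++⁻ˡ xs p ∷ ++-uniqueˡ xs u

++-uniqueʳ : ∀ {A : Set} (xs : List A) {ys} → Unique (xs ++ ys) → Unique ys
++-uniqueʳ []       u       = u
++-uniqueʳ (x ∷ xs) (_ ∷ u) = ++-uniqueʳ xs u

cycles-injective : (bs : List (List (Fin n))) → Unique (concat bs) →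
                   Injective _≡_ _≡_ (foldr (λ b f → cycle b ∘ f) id bs)
cycles-injective []       _ eq = eq
cycles-injective (b ∷ bs) u eq =
  cycles-injective bs (++-uniqueʳ b u) (cycle-injective (++-uniqueˡ b u) eq)

φ-injective : {w : List (Fin n)} → Unique w → Injective _≡_ _≡_ (φ-function w)
φ-injective {w = w} u =
  cycles-injective (cutAfterRLMinima w) (subst Unique (sym (concat-cutAfterRLMinima w)) u)

insertBefore-↭ : ∀ (j : Fin n) xs {w} → j ∈ w → insertBefore j xs w ↭ xs ++ w
insertBefore-↭ j xs {k ∷ w} j∈ with k ≟ j
... | yes _ = ↭-refl
insertBefore-↭ j xs {k ∷ w} (here eq)  | no k≢j = contradiction (sym eq) k≢j
insertBefore-↭ j xs {k ∷ w} (there j∈) | no _   =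
  ↭-trans (prep k (insertBefore-↭ j xs j∈)) (↭-sym (shift k xs w))

unique-singleton : ∀ {A : Set} {x : A} {xs} → Unique xs → x ∈ xs →
                   (∀ {y} → y ∈ xs → y ≡ x) → xs ≡ x ∷ []
unique-singleton {xs = y ∷ []}      u x∈ only = cong (_∷ []) (only (here refl))
unique-singleton {xs = y ∷ z ∷ xs} ((y≢z ∷ _) ∷ u) x∈ only =
  contradiction (trans (only (here refl)) (sym (only (there (here refl))))) y≢z

markOf-↑ : {A B : Set} (a? : Dec A) (b? : Dec B) → markOf a? b? ≡ ↑ → A
markOf-↑ (yes a) _       _ = a
markOf-↑ (no _)  (yes _) ()
markOf-↑ (no _)  (no _)  ()

↑-markOf : {A B : Set} (a? : Dec A) (b? : Dec B) → A → markOf a? b? ≡ ↑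
↑-markOf (yes _) _ _ = refl
↑-markOf (no ¬a) _ a = contradiction a ¬a

markOf-← : {A B : Set} (a? : Dec A) (b? : Dec B) → markOf a? b? ≡ ← → B
markOf-← (no _) (yes b) _ = b

←-markOf : {A B : Set} (a? : Dec A) (b? : Dec B) → ¬ A → B → markOf a? b? ≡ ←
←-markOf (yes a) _       ¬a _ = contradiction a ¬a
←-markOf (no _)  (yes _) _  _ = refl
←-markOf (no _)  (no ¬b) _  b = contradiction b ¬b

minimal : {P : Fin n → Set} → (∀ i → Dec (P i)) → ∃ P →
          ∃ λ i → P i × (∀ j → j < i → ¬ P j)
minimal {n = ℕ.suc n} P? (k , pk) with P? zero
... | yes p₀ = zero , p₀ , λ _ ()
minimal {n = ℕ.suc n} P? (zero  , pk) | no ¬p₀ = contradiction pk ¬p₀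
minimal {n = ℕ.suc n} P? (suc k , pk) | no ¬p₀ with minimal (P? ∘ suc) (k , pk)
... | i , pi , least = suc i , pi , λ
  { zero    _   → ¬p₀
  ; (suc j) j<i → least j (ℕ.s<s⁻¹ j<i) }

minimal-unique : {P : Fin n → Set} {i j : Fin n} →
  P i → (∀ k → k < i → ¬ P k) → P j → (∀ k → k < j → ¬ P k) → i ≡ j
minimal-unique {i = i} {j} pi li pj lj with <-cmp i j
... | tri< i<j _ _ = contradiction pi (lj i i<j)
... | tri≈ _ eq _  = eq
... | tri> _ _ j<i = contradiction pj (li j j<i)

allFin-sorted : ∀ n → AllPairs _<_ (allFin n)
allFin-sorted n = AllPairs.tabulate⁺-< id

ʳ++-sorted : ∀ {A : Set} {R : A → A → Set} xs {ys} → AllPairs (flip R) xs → AllPairs R ys →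
             All (λ x → All (R x) ys) xs → AllPairs R (xs ʳ++ ys)
ʳ++-sorted []       _        s _        = s
ʳ++-sorted (x ∷ xs) (p ∷ s′) s (q ∷ qs) =
  ʳ++-sorted xs s′ (q ∷ s) (All.zipWith (λ (r , rs) → r ∷ rs) (p , qs))

ʳ++-sorted⁻ : ∀ {A : Set} {R : A → A → Set} xs {ys} → AllPairs R (xs ʳ++ ys) →
              AllPairs R ys × All (λ x → All (R x) ys) xs
ʳ++-sorted⁻ []       s = s , []
ʳ++-sorted⁻ (x ∷ xs) s with ʳ++-sorted⁻ xs s
... | p ∷ s′ , qs = s′ , p ∷ All.map All.tail qs

reverse-sorted : ∀ {A : Set} {R : A → A → Set} {xs} → AllPairs R xs → AllPairs (flip R) (reverse xs)
reverse-sorted {xs = xs} s = ʳ++-sorted xs s [] (All.universal (λ _ → []) xs)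

∈-ʳ++ʳ : ∀ {A : Set} {x : A} xs {ys} → x ∈ ys → x ∈ xs ʳ++ ys
∈-ʳ++ʳ []       x∈ = x∈
∈-ʳ++ʳ (y ∷ xs) x∈ = ∈-ʳ++ʳ xs (there x∈)

∈-ʳ++ : ∀ {A : Set} {x : A} xs {ys} → x ∈ xs ʳ++ ys → x ∈ xs ⊎ x ∈ ys
∈-ʳ++ []       x∈ = inj₂ x∈
∈-ʳ++ (y ∷ xs) x∈ with ∈-ʳ++ xs x∈
... | inj₁ x∈xs         = inj₁ (there x∈xs)
... | inj₂ (here eq)    = inj₁ (here eq)
... | inj₂ (there x∈ys) = inj₂ x∈ys

module _ (T : PT n) where
  open PT T

  one⇒¬zero : ∀ {r c} → One r c → ¬ Zero r c
  one⇒¬zero (p , eq) (q , eq′) with () ← trans (sym eq) eq′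

  ↑⇒topmost : ∀ {r c} → alternative T r c ≡ ↑ → TopmostOne r c
  ↑⇒topmost {r} {c} = markOf-↑ (topmostOne? r c) (rightmostRestrictedZero? r c)

  topmost⇒↑ : ∀ {r c} → TopmostOne r c → alternative T r c ≡ ↑
  topmost⇒↑ {r} {c} = ↑-markOf (topmostOne? r c) (rightmostRestrictedZero? r c)

  ←⇒rightmost : ∀ {r c} → alternative T r c ≡ ← → RightmostRestrictedZero r c
  ←⇒rightmost {r} {c} = markOf-← (topmostOne? r c) (rightmostRestrictedZero? r c)

  rightmost⇒← : ∀ {r c} → RightmostRestrictedZero r c → alternative T r c ≡ ←
  rightmost⇒← {r} {c} z@((z₀ , _) , _) =
    ←-markOf (topmostOne? r c) (rightmostRestrictedZero? r c)
      (λ { (o , _) → one⇒¬zero o z₀ }) z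

  turnsAt⇒cell : ∀ {r c} → turnsAt T r c ≡ true → Cell r c
  turnsAt⇒cell {r} {c} eq with alternative T r c in alt
  ... | ↑ = proj₁ (proj₁ (↑⇒topmost alt))
  ... | ← = proj₁ (proj₁ (proj₁ (←⇒rightmost alt)))

  row-has-← : ∀ {r} → kind r ≡ row → ¬ UnrestrictedRow r → ∃ λ c → RightmostRestrictedZero r c
  row-has-← {r} isRow restricted = minimal (restrictedZero? r)
    (decidable-stable (any? (restrictedZero? r)) λ none →
      restricted (isRow , λ c z → none (c , z)))

  row≢column : ∀ {i} → kind i ≡ row → kind i ≢ column
  row≢column p q with () ← trans (sym p) q

  data Inserted (cs : List (Fin n)) (i : Fin n) : Set where
    unrestricted : UnrestrictedRow i → Inserted cs i
    restricted   : ∀ {c} → c ∈ cs → alternative T i c ≡ ← → Inserted cs i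
    column       : i ∈ cs → Inserted cs i

  record ValidWord (cs w : List (Fin n)) : Set where
    field
      w-unique : Unique w
      sound    : ∀ {i} → i ∈ w → Inserted cs i
      covers   : ∀ {i} → Inserted cs i → i ∈ w

  columns : List (Fin n)
  columns = columnsLeftToRight T

  columns-sorted : AllPairs (λ c c′ → c′ < c) columns
  columns-sorted = AllPairs.filter⁺ (λ c → kind c ≟ᵏ column) (reverse-sorted (allFin-sorted n))

  ∈-columns : ∀ {c} → kind c ≡ column → c ∈ columns
  ∈-columns {c} = ∈-filter⁺ (λ c → kind c ≟ᵏ column) (Any.reverse⁺ (∈-allFin c))

  columns-column : ∀ {c} → c ∈ columns → kind c ≡ column
  columns-column c∈ = proj₂ (∈-filter⁻ (λ c → kind c ≟ᵏ column) {xs = reverse (allFin n)} c∈)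

  ∈-rowsMarked⁺ : ∀ {m r c} → alternative T r c ≡ m → r ∈ rowsMarked T m c
  ∈-rowsMarked⁺ {m} {r} {c} = ∈-filter⁺ (λ r → alternative T r c ≟ᵐ m) (∈-allFin r)

  ∈-rowsMarked⁻ : ∀ {m r c} → r ∈ rowsMarked T m c → alternative T r c ≡ m
  ∈-rowsMarked⁻ {m} {r} {c} r∈ =
    proj₂ (∈-filter⁻ (λ r → alternative T r c ≟ᵐ m) {xs = allFin n} r∈)

  rowsMarked-unique : ∀ m c → Unique (rowsMarked T m c)
  rowsMarked-unique m c = Unique.filter⁺ (λ r → alternative T r c ≟ᵐ m) (Unique.allFin⁺ n)

  column-has-↑ : ∀ {c} → kind c ≡ column → ∃ λ j → TopmostOne j c
  column-has-↑ {c} isColumn = minimal (λ r → one? r c) (column-has-one c isColumn)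

  rowsMarked-↑ : ∀ {j c} → TopmostOne j c → rowsMarked T ↑ c ≡ j ∷ []
  rowsMarked-↑ t@(o , least) =
    unique-singleton (rowsMarked-unique ↑ _) (∈-rowsMarked⁺ (topmost⇒↑ t)) λ y∈ →
      let (o′ , least′) = ↑⇒topmost (∈-rowsMarked⁻ y∈) in
      minimal-unique o′ least′ o least

  step-valid : ∀ {P c cs w} → P ʳ++ (c ∷ cs) ≡ columns →
               ValidWord P w → ValidWord (c ∷ P) (insertColumn T w c)
  step-valid {P} {c} {cs} {w} split valid = result
    where
    open ValidWord valid

    c∈columns : c ∈ columns
    c∈columns = subst (c ∈_) split (∈-ʳ++ʳ P (here refl))

    cColumn : kind c ≡ column
    cColumn = columns-column c∈columns

    P-column : ∀ {x} → x ∈ P → kind x ≡ column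
    P-column x∈ = columns-column (subst (_ ∈_) (trans (sym (ʳ++-defn P)) split)
      (∈-++⁺ˡ (Any.reverse⁺ x∈)))

    sorted = ʳ++-sorted⁻ P (subst (AllPairs _) (sym split) columns-sorted)

    right-of-c : ∀ {x} → x ∈ cs → x < c
    right-of-c x∈ = All.lookup (AllPairs.head (proj₁ sorted)) x∈

    left-of-c : ∀ {x} → x ∈ P → c < x
    left-of-c x∈ = All.head (All.lookup (proj₂ sorted) x∈)

    c∉P : c ∉ P
    c∉P c∈ = <-irrefl refl (left-of-c c∈)

    j    = proj₁ (column-has-↑ cColumn)
    top  = proj₂ (column-has-↑ cColumn)
    jRow = proj₁ (proj₁ (proj₁ top))

    ←-left-of-c : ∀ {c₀} → RightmostRestrictedZero j c₀ → c₀ ∈ P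
    ←-left-of-c {c₀} ((z , r′ , r′<j , o) , _) with ∈-ʳ++ P (subst (c₀ ∈_) (sym split)
                                     (∈-columns (proj₁ (proj₂ (proj₁ z)))))
    ... | inj₁ c₀∈          = c₀∈
    ... | inj₂ (here refl)  = contradiction z (one⇒¬zero (proj₁ top))
    ... | inj₂ (there c₀∈)  = contradiction z
      (no-zero-below-and-right-of-ones r′<j o (right-of-c c₀∈) (proj₁ top))

    j∈w : j ∈ w
    j∈w with unrestrictedRow? j
    ... | yes u = covers (unrestricted u)
    ... | no ¬u = let (c₀ , z) = row-has-← jRow ¬u in
      covers (restricted (←-left-of-c z) (rightmost⇒← z))

    block = rowsMarked T ← c ∷ʳ c

    inserted : insertColumn T w c ↭ block ++ w
    inserted rewrite rowsMarked-↑ top = insertBefore-↭ j block j∈w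

    ←-row : ∀ {r c′} → alternative T r c′ ≡ ← → kind r ≡ row
    ←-row eq = proj₁ (proj₁ (proj₁ (proj₁ (←⇒rightmost eq))))

    block-unique : Unique block
    block-unique = Unique.++⁺ (rowsMarked-unique ← c) ([] ∷ [])
      λ { (x∈ , here refl) → row≢column (←-row (∈-rowsMarked⁻ x∈)) cColumn }

    disjoint : ∀ {x} → x ∈ block × x ∈ w → ⊥
    disjoint (x∈b , x∈w) with ∈-++⁻ (rowsMarked T ← c) x∈b | sound x∈w
    ... | inj₁ x∈ | unrestricted (_ , u)    = u c (proj₁ (←⇒rightmost (∈-rowsMarked⁻ x∈)))
    ... | inj₁ x∈ | restricted {c′} c′∈ eq  =
      let (z , least)   = ←⇒rightmost (∈-rowsMarked⁻ x∈)
          (z′ , least′) = ←⇒rightmost eq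
      in c∉P (subst (_∈ P) (minimal-unique z′ least′ z least) c′∈)
    ... | inj₁ x∈ | column x∈P              =
      row≢column (←-row (∈-rowsMarked⁻ x∈)) (P-column x∈P)
    ... | inj₂ (here refl) | unrestricted (isRow , _) = row≢column isRow cColumn
    ... | inj₂ (here refl) | restricted _ eq          = row≢column (←-row eq) cColumn
    ... | inj₂ (here refl) | column c∈                = c∉P c∈

    sound′ : ∀ {i} → i ∈ block ++ w → Inserted (c ∷ P) i
    sound′ i∈ with ∈-++⁻ block i∈
    ... | inj₁ i∈b with ∈-++⁻ (rowsMarked T ← c) i∈b
    ... | inj₁ i∈r         = restricted (here refl) (∈-rowsMarked⁻ i∈r)
    ... | inj₂ (here refl) = column (here refl)
    sound′ i∈ | inj₂ i∈w with sound i∈w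
    ... | unrestricted u   = unrestricted u
    ... | restricted c∈ eq = restricted (there c∈) eq
    ... | column i∈P       = column (there i∈P)

    covers′ : ∀ {i} → Inserted (c ∷ P) i → i ∈ block ++ w
    covers′ (unrestricted u)           = ∈-++⁺ʳ block (covers (unrestricted u))
    covers′ (restricted (here refl) e) = ∈-++⁺ˡ (∈-++⁺ˡ (∈-rowsMarked⁺ e))
    covers′ (restricted (there c∈) e)  = ∈-++⁺ʳ block (covers (restricted c∈ e))
    covers′ (column (here refl))       = ∈-++⁺ˡ (∈-++⁺ʳ (rowsMarked T ← c) (here refl))
    covers′ (column (there i∈))        = ∈-++⁺ʳ block (covers (column i∈))

    result : ValidWord (c ∷ P) (insertColumn T w c)
    result = record
      { w-unique = SetoidPerm.Unique-resp-↭ (setoid (Fin n)) (↭⇒↭ₛ (↭-sym inserted))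
                     (Unique.++⁺ block-unique w-unique disjoint)
      ; sound    = λ i∈ → sound′ (∈-resp-↭ inserted i∈)
      ; covers   = λ i → ∈-resp-↭ (↭-sym inserted) (covers′ i)
      }

  fold-valid : ∀ P cs {w} → P ʳ++ cs ≡ columns → ValidWord P w →
               ∃ λ Q → Q ʳ++ [] ≡ columns × ValidWord Q (foldl (insertColumn T) w cs)
  fold-valid P []       split valid = P , split , valid
  fold-valid P (c ∷ cs) split valid = fold-valid (c ∷ P) cs split (step-valid split valid)

  start-valid : ValidWord [] (filter unrestrictedRow? (allFin n))
  start-valid = record
    { w-unique = Unique.filter⁺ unrestrictedRow? (Unique.allFin⁺ n)
    ; sound    = λ i∈ → unrestricted (proj₂ (∈-filter⁻ unrestrictedRow? {xs = allFin n} i∈))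
    ; covers   = λ { (unrestricted u) → ∈-filter⁺ unrestrictedRow? (∈-allFin _) u }
    }

  Φ-unique : Unique (Φ-letters T)
  Φ-unique with fold-valid [] columns refl start-valid
  ... | _ , _ , valid = ValidWord.w-unique valid

  Φ-complete : ∀ i → i ∈ Φ-letters T
  Φ-complete i with Q , split , valid ← fold-valid [] columns refl start-valid
    = ValidWord.covers valid inserted
    where
    ∈Q : ∀ {c} → kind c ≡ column → c ∈ Q
    ∈Q isColumn with ∈-ʳ++ Q (subst (_ ∈_) (sym split) (∈-columns isColumn))
    ... | inj₁ c∈ = c∈

    inserted : Inserted Q i
    inserted with kind i in k
    ... | column = column (∈Q k)
    ... | row with unrestrictedRow? i
    ... | yes u = unrestricted u
    ... | no ¬u = let (c , z) = row-has-← k ¬u in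
      restricted (∈Q (proj₁ (proj₂ (proj₁ (proj₁ (proj₁ z)))))) (rightmost⇒← z)

toList-init-last : ∀ {A : Set} {d} (xs : Vec A (ℕ.suc d)) ys →
  Vec.toList (init xs) ++ last xs ∷ ys ≡ Vec.toList xs ++ ys
toList-init-last (x ∷ [])         ys = refl
toList-init-last (x ∷ xs@(_ ∷ _)) ys = cong (x ∷_) (toList-init-last xs ys)

module _ {i : Fin n} (b a : List (Fin n)) (split : b ʳ++ (i ∷ a) ≡ allFin n) where
  private
    sorted = ʳ++-sorted⁻ b (subst (AllPairs _<_) (sym split) (allFin-sorted n))
    i<a : All (i <_) a
    i<a = AllPairs.head (proj₁ sorted)
    b<i : All (_< i) (reverse b)
    b<i = All.tabulate (λ x∈ → All.head (All.lookup (proj₂ sorted) (Any.reverse⁻ x∈)))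

    split′ : reverse b ++ i ∷ a ≡ allFin n
    split′ = trans (sym (ʳ++-defn b)) split

  below-split : below i ≡ reverse b
  below-split rewrite sym split′
    | filter-++ (_<? i) (reverse b) (i ∷ a)
    | filter-all (_<? i) b<i
    | filter-none (_<? i) {xs = i ∷ a} (<-irrefl refl ∷ All.map (λ i<x x<i → <-asym i<x x<i) i<a)
    = ++-identityʳ (reverse b)

  above-split : above i ≡ a
  above-split rewrite sym split′
    | filter-++ (i <?_) (reverse b) (i ∷ a)
    | filter-none (i <?_) (All.map (λ x<i i<x → <-asym x<i i<x) b<i)
    | filter-reject (i <?_) {xs = a} (<-irrefl {x = i} refl)
    = filter-all (i <?_) i<a

split-at : (i : Fin n) → reverse (below i) ʳ++ (i ∷ above i) ≡ allFin n
split-at {n} i with xs , ys , eq ← ∈-∃++ (∈-allFin i) = lemma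
  where
  split : reverse xs ʳ++ (i ∷ ys) ≡ allFin n
  split = trans (ʳ++-defn (reverse xs))
            (trans (cong (_++ i ∷ ys) (reverse-involutive xs)) (sym eq))
  lemma : reverse (below i) ʳ++ (i ∷ above i) ≡ allFin n
  lemma rewrite below-split (reverse xs) ys split | above-split (reverse xs) ys split
    | reverse-involutive (reverse xs) = split

module _ (T : PT n) where
  open PT T

  -- The path followed backwards; b and a list the labels still to be met
  -- before and after the current range, nearest first.
  west north : Fin n → List (Fin n) → List (Fin n) → Fin n
  west r b []      = r
  west r b (c ∷ a) = if turnsAt T r c then north c b a else west r b a
  north c []      a = c
  north c (r ∷ b) a = if turnsAt T r c then west r b a else north c b a

  back : Fin n → Fin n
  back j with kind j
  ... | row    = west  j (reverse (below j)) (above j)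
  ... | column = north j (reverse (below j)) (above j)

  back-row : ∀ {j} → kind j ≡ row → back j ≡ west j (reverse (below j)) (above j)
  back-row eq rewrite eq = refl

  back-column : ∀ {j} → kind j ≡ column → back j ≡ north j (reverse (below j)) (above j)
  back-column eq rewrite eq = refl

  back-east : ∀ {d r} b (xs : Vec (Fin n) d) a → kind r ≡ row →
    b ʳ++ (r ∷ Vec.toList xs ++ a) ≡ allFin n → back (east T r xs) ≡ west r b a
  back-south : ∀ {d c} b (xs : Vec (Fin n) d) a → kind c ≡ column →
    b ʳ++ (Vec.toList xs ++ c ∷ a) ≡ allFin n → back (south T c xs) ≡ north c b a

  back-east {r = r} b [] a isRow split
    rewrite back-row isRow | below-split b a split | above-split b a split
    | reverse-involutive b = refl
  back-east {r = r} b xs@(_ ∷ _) a isRow split with turnsAt T r (last xs) in turn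
  ... | true  = trans
    (back-south (r ∷ b) (init xs) a (proj₁ (proj₂ (turnsAt⇒cell T turn)))
      (trans (cong (λ l → b ʳ++ (r ∷ l)) (toList-init-last xs a)) split))
    (cong (if_then west r b a else north (last xs) b a) turn)
  ... | false = trans
    (back-east b (init xs) (last xs ∷ a) isRow
      (trans (cong (λ l → b ʳ++ (r ∷ l)) (toList-init-last xs a)) split))
    (cong (if_then north (last xs) b a else west r b a) turn)

  back-south {c = c} b [] a isColumn split
    rewrite back-column isColumn | below-split b a split | above-split b a split
    | reverse-involutive b = refl
  back-south {c = c} b (r ∷ xs) a isColumn split with turnsAt T r c in turn
  ... | true  = trans (back-east b xs (c ∷ a) (proj₁ (turnsAt⇒cell T turn)) split)
    (cong (if_then north c b a else west r b a) turn)
  ... | false = trans (back-south (r ∷ b) xs a isColumn split)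
    (cong (if_then west r b a else north c b a) turn)

  back-ζ : ∀ i → back (ζ-function T i) ≡ i
  back-ζ i with kind i in k
  ... | row    = back-east (reverse (below i)) (Vec.fromList (above i)) [] k lemma
    where
    lemma : reverse (below i) ʳ++ (i ∷ Vec.toList (Vec.fromList (above i)) ++ []) ≡ allFin n
    lemma rewrite Vec.toList∘fromList (above i) | ++-identityʳ (above i) = split-at i
  ... | column = back-south [] (Vec.fromList (below i)) (above i) k lemma
    where
    lemma : Vec.toList (Vec.fromList (below i)) ++ i ∷ above i ≡ allFin n
    lemma rewrite Vec.toList∘fromList (below i) =
      trans (cong (_++ i ∷ above i) (sym (reverse-involutive (below i))))
        (trans (sym (ʳ++-defn (reverse (below i)))) (split-at i))

  ζ-injective : Injective _≡_ _≡_ (ζ-function T)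
  ζ-injective {x} {y} eq = trans (sym (back-ζ x)) (trans (cong back eq) (back-ζ y))

Φ : PT n → PermWord n
Φ T = record
  { letters  = Φ-letters T
  ; unique   = Φ-unique T
  ; complete = Φ-complete T
  }

φ : PermWord n → Permutation′ n
φ w = fromInjective (φ-function letters) (φ-injective unique)
  where open PermWord w

ζᵃˡᵗ : PT n → Permutation′ n
ζᵃˡᵗ T = fromInjective (ζ-function T) (ζ-injective T)

{-# OPTIONS --safe #-}
module Submission where

-- A path crosses the columns from left to right. If Column c has its ↑ in Row j
-- and its ←'s in the rows i₁ < ⋯ < iᵣ, which all lie below j, then crossing
-- Column c permutes the labels by the cycle (j, i₁, …, iᵣ, c): a path turns south
-- at an arrow and east again at the next one, and c is met last. Hence ζᵃˡᵗ is the
-- composition of these cycles. On the other hand i₁, …, iᵣ, c exceed j, so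
-- inserting them before j creates no right-to-left minimum and destroys none; in
-- the image under φ this prolongs the cycle through j, which amounts to composing
-- with the same cycle (j, i₁, …, iᵣ, c). Initially the word is increasing, and φ
-- sends it to the identity.

open import Defs
open import Data.Nat.Base using (ℕ; _≥_)
open import Data.Fin.Permutation using (_≈_)

open import Data.Bool.Base using (true; false; if_then_else_)
import Data.Bool.Properties as Bool
open import Data.Empty using (⊥)
open import Data.Fin.Base using (Fin; _<_)
open import Data.Fin.Properties using (_≟_; _<?_; <-trans; <-asym; <-irrefl; <-cmp)
open import Data.List.Base
  using (List; []; _∷_; _++_; _∷ʳ_; _ʳ++_; allFin; concat; filter; foldl; foldr; head; map;
         reverse)
open import Data.List.Membership.DecPropositional using () renaming (_∈?_ to mem?)
open import Data.List.Membership.Propositional using (_∈_; _∉_)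
open import Data.List.Membership.Propositional.Properties
  using (∈-++⁺ˡ; ∈-++⁺ʳ; ∈-++⁻; ∈-filter⁻)
open import Data.List.Properties
  using (foldl-++; ++-assoc; ++-identityʳ; ++-ʳ++; ʳ++-ʳ++; ʳ++-defn; reverse-involutive;
         filter-++; filter-none; filter-accept; filter-reject)
open import Data.List.Relation.Binary.Disjoint.Propositional using (Disjoint)
open import Data.List.Relation.Binary.Permutation.Propositional using (↭⇒↭ₛ)
import Data.List.Relation.Binary.Permutation.Setoid.Properties as SetoidPerm
open import Data.List.Relation.Unary.All as All using (All; []; _∷_)
import Data.List.Relation.Unary.All.Properties as All
open import Data.List.Relation.Unary.AllPairs using (AllPairs; []; _∷_)
import Data.List.Relation.Unary.AllPairs.Properties as AllPairs
open import Data.List.Relation.Unary.Any using (here; there)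
import Data.List.Relation.Unary.Any.Properties as Any
open import Data.List.Relation.Unary.Unique.Propositional using (Unique)
open import Data.List.Relation.Unary.Unique.Propositional.Properties using (Unique[x∷xs]⇒x∉xs)
open import Data.Maybe.Base using (fromMaybe)
open import Data.Product.Base using (∃₂; _×_; _,_; proj₁; proj₂)
open import Data.Sum.Base using (_⊎_; inj₁; inj₂)
open import Data.Vec.Base as Vec using (Vec; []; _∷_; init; last)
import Data.Vec.Properties as Vec
open import Function.Base using (_∘_; id)
open import Relation.Binary.Definitions using (tri<; tri≈; tri>)
open import Relation.Binary.PropositionalEquality
  using (_≡_; _≢_; refl; sym; trans; cong; cong₂; subst; setoid; module ≡-Reasoning)
open import Relation.Nullary using (¬_; Dec; yes; no; does; contradiction)
open import Relation.Nullary.Decidable using (dec-true; dec-false)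

private
  variable
    n : ℕ

-- Cycles

successor-here : ∀ a (b c : Fin n) w → successor a (b ∷ c ∷ w) b ≡ c
successor-here a b c w rewrite dec-true (b ≟ b) refl = refl

successor-last : ∀ (a b : Fin n) → successor a (b ∷ []) b ≡ a
successor-last a b rewrite dec-true (b ≟ b) refl = refl

successor-there : ∀ a {b} c w {y : Fin n} → y ≢ b →
  successor a (b ∷ c ∷ w) y ≡ successor a (c ∷ w) y
successor-there a {b} c w {y} y≢b rewrite dec-false (y ≟ b) y≢b = refl

successor-skip : ∀ a u v w {y : Fin n} → y ∉ u →
  successor a (u ++ v ∷ w) y ≡ successor a (v ∷ w) y
successor-skip a []          v w y∉ = refl
successor-skip a (b ∷ [])    v w y∉ = successor-there a v w (y∉ ∘ here)
successor-skip a (b ∷ c ∷ u) v w y∉ =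
  trans (successor-there a c (u ++ v ∷ w) (y∉ ∘ here))
        (successor-skip a (c ∷ u) v w (y∉ ∘ there))

-- The last letter of `u` is followed by `v`, so seen from inside `u` the letter `v` acts as the
-- value to which the list returns.
successor-prefix : ∀ a u v w {y : Fin n} → y ∈ u →
  successor a (u ++ v ∷ w) y ≡ successor v u y
successor-prefix a (b ∷ []) v w (here refl) =
  trans (successor-here a b v w) (sym (successor-last v b))
successor-prefix a (b ∷ c ∷ u) v w {y} y∈ with y ≟ b | y∈
... | yes _  | _         = refl
... | no y≢b | here y≡b  = contradiction y≡b y≢b
... | no _   | there y∈′ = successor-prefix a (c ∷ u) v w y∈′

-- The value at `y` is a letter of `w`, which `f` fixes, or the return value `a`, or `y` itself if
-- `y` is not listed; the second alternative of the last hypothesis covers this third case.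
successor-map : ∀ (f : Fin n → Fin n) a b w {y} → All (λ x → f x ≡ x) w →
  y ∈ b ∷ w ⊎ f y ≡ y → successor (f a) (b ∷ w) y ≡ f (successor a (b ∷ w) y)
successor-map f a b [] {y} _ y∈ with y ≟ b | y∈
... | yes _  | _               = refl
... | no y≢b | inj₁ (here y≡b) = contradiction y≡b y≢b
... | no _   | inj₂ fixed      = sym fixed
successor-map f a b (c ∷ w) {y} (p ∷ ps) y∈ with y ≟ b | y∈
... | yes _  | _                = sym p
... | no y≢b | inj₁ (here y≡b)  = contradiction y≡b y≢b
... | no _   | inj₁ (there y∈′) = successor-map f a c w ps (inj₁ y∈′)
... | no _   | inj₂ fixed       = successor-map f a c w ps (inj₂ fixed)

cycle-∉ : ∀ w {x : Fin n} → x ∉ w → cycle w x ≡ x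
cycle-∉ []      x∉ = refl
cycle-∉ (a ∷ w) x∉ = successor-∉ a a w x∉

cycle-∈ : ∀ w {x : Fin n} → x ∈ w → cycle w x ∈ w
cycle-∈ (a ∷ w) x∈ = successor-∈ a a w x∈

cycle-first : ∀ (j : Fin n) xs → cycle (j ∷ xs) j ≡ fromMaybe j (head xs)
cycle-first j []       = successor-last j j
cycle-first j (e ∷ xs) = successor-here j j e xs

cycle-∷ʳ : ∀ xs (c : Fin n) → cycle (xs ∷ʳ c) ≡ successor (fromMaybe c (head xs)) (xs ∷ʳ c)
cycle-∷ʳ []       c = refl
cycle-∷ʳ (x ∷ xs) c = refl

disjoint-cycles-commute : ∀ {u v : List (Fin n)} → Disjoint u v → ∀ y →
  cycle u (cycle v y) ≡ cycle v (cycle u y)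
disjoint-cycles-commute {u = u} {v} u#v y with mem? _≟_ y u | mem? _≟_ y v
... | yes y∈u | yes y∈v = contradiction (y∈u , y∈v) u#v
... | yes y∈u | no  y∉v =
  trans (cong (cycle u) (cycle-∉ v y∉v)) (sym (cycle-∉ v λ y∈v → u#v (cycle-∈ u y∈u , y∈v)))
... | no  y∉u | yes y∈v =
  trans (cycle-∉ u (λ y∈u → u#v (y∈u , cycle-∈ v y∈v))) (cong (cycle v) (sym (cycle-∉ u y∉u)))
... | no  y∉u | no  y∉v =
  trans (cong (cycle u) (cycle-∉ v y∉v))
        (trans (cycle-∉ u y∉u) (sym (trans (cong (cycle v) (cycle-∉ u y∉u)) (cycle-∉ v y∉v))))

-- Inserting a block of larger letters into a word

++-unique-disjoint : ∀ {A : Set} {x : A} us {vs} → Unique (us ++ vs) → x ∈ us → x ∉ vs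
++-unique-disjoint (_ ∷ us) u       (here refl) x∈ = Unique[x∷xs]⇒x∉xs u (∈-++⁺ʳ us x∈)
++-unique-disjoint (_ ∷ us) (_ ∷ u) (there p)   x∈ = ++-unique-disjoint us u p x∈

cons-to-first-++ : ∀ {A : Set} us (b : List A) bs →
  foldr cons-to-first (b ∷ bs) us ≡ (us ++ b) ∷ bs
cons-to-first-++ []       b bs = refl
cons-to-first-++ (x ∷ us) b bs = cong (cons-to-first x) (cons-to-first-++ us b bs)

-- Exposes the block that starts with a given letter without deciding whether that letter is a
-- right-to-left minimum.
cutAfterRLMinima-∷ : ∀ (x : Fin n) w → ∃₂ λ b bs → cutAfterRLMinima (x ∷ w) ≡ (x ∷ b) ∷ bs
cutAfterRLMinima-∷ x w with does (All.all? (x <?_) w)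
... | true  = [] , cutAfterRLMinima w , refl
... | false with cutAfterRLMinima w
... | []     = [] , [] , refl
... | b ∷ bs = b , bs , refl

module _ (j : Fin n) (xs : List (Fin n)) where

  insertBefore-here : ∀ w → insertBefore j xs (j ∷ w) ≡ xs ++ j ∷ w
  insertBefore-here w rewrite dec-true (j ≟ j) refl = refl

  insertBefore-there : ∀ {k} w → k ≢ j → insertBefore j xs (k ∷ w) ≡ k ∷ insertBefore j xs w
  insertBefore-there {k} w k≢j rewrite dec-false (k ≟ j) k≢j = refl

  insertBefore-∉ : ∀ {w} → j ∉ w → insertBefore j xs w ≡ w
  insertBefore-∉ {[]}    j∉ = refl
  insertBefore-∉ {k ∷ w} j∉ = trans (insertBefore-there w (j∉ ∘ here ∘ sym))
                                    (cong (k ∷_) (insertBefore-∉ (j∉ ∘ there)))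

  All-insertBefore⁺ : ∀ {P : Fin n → Set} {w} → (P j → All P xs) → All P w →
    All P (insertBefore j xs w)
  All-insertBefore⁺ f [] = []
  All-insertBefore⁺ {w = k ∷ w} f (p ∷ ps) with k ≟ j
  ... | yes refl = All.++⁺ (f p) (p ∷ ps)
  ... | no _     = p ∷ All-insertBefore⁺ f ps

  All-insertBefore⁻ : ∀ {P : Fin n → Set} w → All P (insertBefore j xs w) → All P w
  All-insertBefore⁻ [] _ = []
  All-insertBefore⁻ (k ∷ w) ps with k ≟ j
  ... | yes refl = All.++⁻ʳ xs ps
  All-insertBefore⁻ (k ∷ w) (p ∷ ps) | no _ = p ∷ All-insertBefore⁻ w ps

  private
    σ : Fin n → Fin n
    σ = cycle (j ∷ xs)

  -- From a letter of `xs` both sides run through `xs` and end at `j`. From any other letter the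
  -- prefix is skipped, and since `σ` fixes all of `w`, only the return value changes.
  successor-insert-first : ∀ a w {y} → Disjoint xs (j ∷ w) → j ∉ w →
    successor (σ a) (xs ++ j ∷ w) y ≡ σ (successor a (j ∷ w) y)
  successor-insert-first a w {y} xs# j∉w with mem? _≟_ y xs
  ... | no y∉ = trans (successor-skip (σ a) xs j w y∉)
    (successor-map σ a j w
      (All.tabulate λ {x} x∈ → cycle-∉ (j ∷ xs) λ
        { (here refl) → j∉w x∈ ; (there x∈xs) → xs# (x∈xs , there x∈) })
      y∈)
    where
    y∈ : y ∈ j ∷ w ⊎ σ y ≡ y
    y∈ with y ≟ j
    ... | yes y≡j = inj₁ (here y≡j)
    ... | no  y≢j = inj₂ (cycle-∉ (j ∷ xs) λ { (here e) → y≢j e ; (there e) → y∉ e })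
  successor-insert-first a w {y} xs# j∉w | yes y∈ = begin
    successor (σ a) (xs ++ j ∷ w) y ≡⟨ successor-prefix (σ a) xs j w y∈ ⟩
    successor j xs y                ≡⟨ tail-cycle xs y∈ ⟨
    σ y                             ≡⟨ cong σ (successor-∉ a j w λ y∈w → xs# (y∈ , y∈w)) ⟨
    σ (successor a (j ∷ w) y)       ∎
    where
    open ≡-Reasoning
    tail-cycle : ∀ us → y ∈ us → successor j (j ∷ us) y ≡ successor j us y
    tail-cycle (e ∷ us) _ = successor-there j e us λ { refl → xs# (y∈ , here refl) }

  -- A letter `x` is kept in front of the insertion point because the new block is entered from the
  -- predecessor of `j`: this letter used to go to `j` and now goes to `σ j`, the head of `xs` (or
  -- `j` if `xs` is empty).
  successor-insert : ∀ a x w {y} → Disjoint xs (x ∷ w) → Unique (x ∷ w) → x ≢ j → j ∈ w →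
    successor (σ a) (x ∷ insertBefore j xs w) y ≡ σ (successor a (x ∷ w) y)
  successor-insert a x (z ∷ w) {y} xs# (x∉ ∷ u) x≢j j∈ with z ≟ j
  successor-insert a x (z ∷ w) {y} xs# (x∉ ∷ u) x≢j j∈ | yes refl
    with y ≟ x
  ... | yes refl = trans (first xs) (sym (cycle-first j xs))
    where
    first : ∀ us → successor (σ a) (x ∷ us ++ j ∷ w) x ≡ fromMaybe j (head us)
    first []       = successor-here (σ a) x j w
    first (e ∷ us) = successor-here (σ a) x e (us ++ j ∷ w)
  ... | no y≢x = trans (later xs)
    (successor-insert-first a w (λ (p , q) → xs# (p , there q)) (Unique[x∷xs]⇒x∉xs u))
    where
    later : ∀ us → successor (σ a) (x ∷ us ++ j ∷ w) y ≡ successor (σ a) (us ++ j ∷ w) y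
    later []       = successor-there (σ a) j w y≢x
    later (e ∷ us) = successor-there (σ a) e (us ++ j ∷ w) y≢x
  successor-insert a x (z ∷ w) {y} xs# (x∉ ∷ u) x≢j j∈ | no z≢j with y ≟ x
  ... | yes refl = sym (cycle-∉ (j ∷ xs) λ
    { (here e) → z≢j e ; (there z∈) → xs# (z∈ , there (here refl)) })
  ... | no y≢x = successor-insert a z w (λ (p , q) → xs# (p , there q)) u z≢j (tail j∈)
    where
    tail : j ∈ z ∷ w → j ∈ w
    tail (here e)  = contradiction (sym e) z≢j
    tail (there p) = p

  -- A cycle returns to its first letter. If that is `j`, the insertion changes it to `σ j`;
  -- otherwise `σ` fixes it. Either way the return value has the form `σ a` of the two lemmas above.
  cycle-insert : ∀ {w} → Disjoint xs w → Unique w → j ∈ w → ∀ y →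
    cycle (insertBefore j xs w) y ≡ σ (cycle w y)
  cycle-insert {a ∷ w} xs# u j∈ y with a ≟ j
  ... | yes refl = trans (first xs (cycle-first j xs))
                         (successor-insert-first j w xs# (Unique[x∷xs]⇒x∉xs u))
    where
    first : ∀ us → σ j ≡ fromMaybe j (head us) →
            cycle (us ++ j ∷ w) y ≡ successor (σ j) (us ++ j ∷ w) y
    first []       eq = cong (λ k → successor k (j ∷ w) y) (sym eq)
    first (e ∷ us) eq = cong (λ k → successor k (e ∷ us ++ j ∷ w) y) (sym eq)
  cycle-insert {a ∷ w} xs# u (here e) y | no a≢j = contradiction (sym e) a≢j
  cycle-insert {a ∷ w} xs# u (there j∈) y | no a≢j =
    trans (cong (λ k → successor k (a ∷ insertBefore j xs w) y)
             (sym (cycle-∉ (j ∷ xs) λ { (here e) → a≢j e ; (there a∈) → xs# (a∈ , here refl) })))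
          (successor-insert a a w xs# u a≢j j∈)

  map-insertBefore-∉ : ∀ {bs} → j ∉ concat bs → map (insertBefore j xs) bs ≡ bs
  map-insertBefore-∉ {[]}     j∉ = refl
  map-insertBefore-∉ {b ∷ bs} j∉
    rewrite insertBefore-∉ {b} (j∉ ∘ ∈-++⁺ˡ) = cong (b ∷_) (map-insertBefore-∉ (j∉ ∘ ∈-++⁺ʳ b))

  -- Uniqueness puts `j` in exactly one block. The factor `σ` arising there is moved outwards past
  -- the cycles of the blocks before it, which are disjoint from `j ∷ xs`.
  cycles-insert : ∀ bs → Disjoint xs (concat bs) → Unique (concat bs) → j ∈ concat bs → ∀ y →
    foldr (λ b f → cycle b ∘ f) id (map (insertBefore j xs) bs) y ≡
    σ (foldr (λ b f → cycle b ∘ f) id bs y)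
  cycles-insert (b ∷ bs) xs# u j∈ y with mem? _≟_ j b
  ... | yes j∈b rewrite map-insertBefore-∉ {bs} (++-unique-disjoint b u j∈b) =
    cycle-insert (λ (p , q) → xs# (p , ∈-++⁺ˡ q)) (++-uniqueˡ b u) j∈b _
  ... | no j∉b with ∈-++⁻ b j∈
  ... | inj₁ j∈b  = contradiction j∈b j∉b
  ... | inj₂ j∈bs rewrite insertBefore-∉ j∉b =
    trans (cong (cycle b)
             (cycles-insert bs (λ (p , q) → xs# (p , ∈-++⁺ʳ b q)) (++-uniqueʳ b u) j∈bs y))
          (disjoint-cycles-commute {u = b} {j ∷ xs} (λ
            { (p , here refl) → j∉b p ; (p , there q) → xs# (q , ∈-++⁺ˡ p) }) _)

  -- The smaller letter `j` stands to the right of every letter of `us`, so none of these is a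
  -- right-to-left minimum and no cut follows it.
  cutAfterRLMinima-++ : ∀ us w → All (j <_) us →
    cutAfterRLMinima (us ++ j ∷ w) ≡ foldr cons-to-first (cutAfterRLMinima (j ∷ w)) us
  cutAfterRLMinima-++ []       w _ = refl
  cutAfterRLMinima-++ (x ∷ us) w (j<x ∷ ps)
    rewrite dec-false (All.all? (x <?_) (us ++ j ∷ w))
              (λ all → <-asym j<x (All.head (All.++⁻ʳ us all)))
    = cong (cons-to-first x) (cutAfterRLMinima-++ us w ps)

  -- A letter in front of `j` that is below everything to its right is below `j`, hence below all of
  -- `xs`, so the insertion does not change its status. The inserted letters are no minima because
  -- of `j`; they only enlarge its block.
  cutAfterRLMinima-insertBefore : All (j <_) xs → ∀ w → Unique w →
    cutAfterRLMinima (insertBefore j xs w) ≡ map (insertBefore j xs) (cutAfterRLMinima w)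
  cutAfterRLMinima-insertBefore j<xs [] _ = refl
  cutAfterRLMinima-insertBefore j<xs (x ∷ w) u with x ≟ j
  ... | yes refl with b , bs , eq ← cutAfterRLMinima-∷ j w = begin
    cutAfterRLMinima (xs ++ j ∷ w)                    ≡⟨ cutAfterRLMinima-++ xs w j<xs ⟩
    foldr cons-to-first (cutAfterRLMinima (j ∷ w)) xs
      ≡⟨ cong (λ l → foldr cons-to-first l xs) eq ⟩
    foldr cons-to-first ((j ∷ b) ∷ bs) xs             ≡⟨ cons-to-first-++ xs (j ∷ b) bs ⟩
    (xs ++ j ∷ b) ∷ bs
      ≡⟨ cong₂ _∷_ (insertBefore-here b) (map-insertBefore-∉ j∉bs) ⟨
    map (insertBefore j xs) ((j ∷ b) ∷ bs)            ≡⟨ cong (map (insertBefore j xs)) eq ⟨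
    map (insertBefore j xs) (cutAfterRLMinima (j ∷ w)) ∎
    where
    open ≡-Reasoning
    j∉bs : j ∉ concat bs
    j∉bs = ++-unique-disjoint (j ∷ b)
      (subst Unique (sym (trans (sym (cong concat eq)) (concat-cutAfterRLMinima (j ∷ w)))) u)
      (here refl)
  cutAfterRLMinima-insertBefore j<xs (x ∷ w) (_ ∷ u) | no x≢j
    with ih ← cutAfterRLMinima-insertBefore j<xs w u
    with All.all? (x <?_) w | All.all? (x <?_) (insertBefore j xs w)
  ... | yes _ | yes _ = cong₂ _∷_ (sym (insertBefore-there [] x≢j)) ih
  ... | yes p | no ¬q = contradiction
    (All-insertBefore⁺ (λ x<j → All.map (<-trans x<j) j<xs) p) ¬q
  ... | no ¬p | yes q = contradiction (All-insertBefore⁻ w q) ¬p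
  ... | no _  | no _  = trans (cong (cons-to-first x) ih) (lemma (cutAfterRLMinima w))
    where
    lemma : ∀ bs → cons-to-first x (map (insertBefore j xs) bs) ≡
                   map (insertBefore j xs) (cons-to-first x bs)
    lemma []       = cong (_∷ []) (sym (insertBefore-there [] x≢j))
    lemma (b ∷ bs) = cong (_∷ map (insertBefore j xs) bs) (sym (insertBefore-there b x≢j))

  φ-insertBefore : ∀ {w} → All (j <_) xs → Disjoint xs w → Unique w → j ∈ w → ∀ y →
    φ-function (insertBefore j xs w) y ≡ cycle (j ∷ xs) (φ-function w y)
  φ-insertBefore {w} j<xs xs# u j∈ y
    rewrite cutAfterRLMinima-insertBefore j<xs w u =
    cycles-insert (cutAfterRLMinima w)
      (subst (Disjoint xs) cut xs#) (subst Unique cut u) (subst (j ∈_) cut j∈) y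
    where
    cut : w ≡ concat (cutAfterRLMinima w)
    cut = sym (concat-cutAfterRLMinima w)

-- Increasing words, values of cycles and splittings of the labels

cycle-singleton : ∀ (x y : Fin n) → cycle (x ∷ []) y ≡ y
cycle-singleton x y with y ≟ x
... | yes refl = refl
... | no _     = refl

-- In an increasing word every letter is a right-to-left minimum, so all cycles have length one.
φ-sorted : ∀ {w : List (Fin n)} → AllPairs _<_ w → ∀ y → φ-function w y ≡ y
φ-sorted [] y = refl
φ-sorted {w = x ∷ w} (p ∷ ps) y rewrite dec-true (All.all? (x <?_) w) p =
  trans (cycle-singleton x _) (φ-sorted ps y)

-- The default is `c` because `c` follows the last letter of `u ++ r ∷ v`; the wrap-around value is
-- never reached from `r`.
cycle-next : ∀ u {r : Fin n} v c → r ∉ u →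
  cycle ((u ++ r ∷ v) ∷ʳ c) r ≡ fromMaybe c (head v)
cycle-next u {r} v c r∉u
  rewrite cycle-∷ʳ (u ++ r ∷ v) c | ++-assoc u (r ∷ v) (c ∷ []) =
  trans (successor-skip a u r (v ∷ʳ c) r∉u) (next v)
  where
  a = fromMaybe c (head (u ++ r ∷ v))
  next : ∀ v → successor a (r ∷ v ∷ʳ c) r ≡ fromMaybe c (head v)
  next []      = successor-here a r c []
  next (s ∷ v) = successor-here a r s (v ∷ʳ c)

cycle-of-last : ∀ u (c : Fin n) → c ∉ u → cycle (u ∷ʳ c) c ≡ fromMaybe c (head u)
cycle-of-last u c c∉u rewrite cycle-∷ʳ u c =
  trans (successor-skip _ u c [] c∉u) (successor-last _ c)

filter-cong-local : ∀ {A : Set} {P Q : A → Set} (P? : ∀ x → Dec (P x)) (Q? : ∀ x → Dec (Q x)) →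
  ∀ {xs} → All (λ x → (P x → Q x) × (Q x → P x)) xs → filter P? xs ≡ filter Q? xs
filter-cong-local P? Q? []                      = refl
filter-cong-local P? Q? {x ∷ xs} ((f , g) ∷ ps) with P? x | Q? x
... | yes p | yes q = cong (x ∷_) (filter-cong-local P? Q? ps)
... | yes p | no ¬q = contradiction (f p) ¬q
... | no ¬p | yes q = contradiction (g q) ¬p
... | no _  | no _  = filter-cong-local P? Q? ps

labels-split : (i : Fin n) → below i ++ i ∷ above i ≡ allFin n
labels-split i = begin
  below i ++ i ∷ above i                     ≡⟨ cong (_++ i ∷ above i) (reverse-involutive (below i)) ⟨
  reverse (reverse (below i)) ++ i ∷ above i ≡⟨ ʳ++-defn (reverse (below i)) ⟨
  reverse (below i) ʳ++ (i ∷ above i)        ≡⟨ split-at i ⟩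
  allFin _                                   ∎
  where open ≡-Reasoning

reverse-split : (i : Fin n) → above i ʳ++ i ∷ reverse (below i) ≡ reverse (allFin n)
reverse-split i = trans (sym (++-ʳ++ (below i))) (cong reverse (labels-split i))

foldl-filter : ∀ {A B : Set} {P : A → Set} (P? : ∀ x → Dec (P x)) (f : B → A → B) →
  (∀ {x} → ¬ P x → ∀ y → f y x ≡ y) → ∀ y xs → foldl f y (filter P? xs) ≡ foldl f y xs
foldl-filter P? f fixes y []       = refl
foldl-filter P? f fixes y (x ∷ xs) with P? x
... | yes _ = foldl-filter P? f fixes (f y x) xs
... | no ¬p = trans (foldl-filter P? f fixes y xs)
                    (cong (λ z → foldl f z xs) (sym (fixes ¬p y)))

-- Crossing a column, and the image of `Φ` under `φ`

module _ (T : PT n) where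
  open PT T

  turns? : ∀ c r → Dec (turnsAt T r c ≡ true)
  turns? c r = turnsAt T r c Bool.≟ true

  turning : Fin n → List (Fin n) → List (Fin n)
  turning c = filter (turns? c)

  -- From the row where a path enters Column c on the left to the row where it
  -- leaves it on the right. The label c itself stands for the path that enters
  -- from the top, and for the one that leaves through the bottom.
  cross : Fin n → Fin n → Fin n
  cross c = cycle (turning c (allFin n) ∷ʳ c)

  turnsAt⇒arrow : ∀ {r c} → turnsAt T r c ≡ true → alternative T r c ≡ ↑ ⊎ alternative T r c ≡ ←
  turnsAt⇒arrow {r} {c} eq with alternative T r c
  ... | ↑ = inj₁ refl
  ... | ← = inj₂ refl

  -- Above Row `j` there is no arrow, since an `↑` there, or the 1 above a `←` there, would be a
  -- higher 1. Below it there is no second `↑`. The arrows read downwards thus come in the order in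
  -- which `Φ` inserts their rows.
  topmost⇒turning : ∀ {j c} → TopmostOne j c → turning c (allFin n) ≡ j ∷ rowsMarked T ← c
  topmost⇒turning {j} {c} t@(o , least) = begin
    turning c (allFin n)                         ≡⟨ cong (turning c) (labels-split j) ⟨
    turning c (below j ++ j ∷ above j)           ≡⟨ filter-++ (turns? c) (below j) (j ∷ above j) ⟩
    turning c (below j) ++ turning c (j ∷ above j)
      ≡⟨ cong (_++ turning c (j ∷ above j)) (filter-none (turns? c) (All.map no-turn rows-above-j)) ⟩
    turning c (j ∷ above j)                      ≡⟨ filter-accept (turns? c) j-turns ⟩
    j ∷ turning c (above j)
      ≡⟨ cong (j ∷_) (filter-cong-local (turns? c) ←? (All.map only-← (All.all-filter (j <?_) (allFin n)))) ⟩
    -- From here on the labels up to `j` are put back; none of them carries `←`.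
    j ∷ filter ←? (above j)                          ≡⟨ cong (j ∷_) (filter-reject ←? j-not-←) ⟨
    j ∷ filter ←? (j ∷ above j)
      ≡⟨ cong (λ l → j ∷ l ++ filter ←? (j ∷ above j))
              (filter-none ←? (All.map (λ r<j → no-turn r<j ∘ cong isArrow) rows-above-j)) ⟨
    j ∷ filter ←? (below j) ++ filter ←? (j ∷ above j)
      ≡⟨ cong (j ∷_) (filter-++ ←? (below j) (j ∷ above j)) ⟨
    j ∷ filter ←? (below j ++ j ∷ above j)           ≡⟨ cong (λ l → j ∷ filter ←? l) (labels-split j) ⟩
    j ∷ filter ←? (allFin n)                         ∎
    where
    open ≡-Reasoning
    ←? = λ r → alternative T r c ≟ᵐ ←

    rows-above-j : All (_< j) (below j)
    rows-above-j = All.all-filter (_<? j) (allFin n)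

    j-turns : turnsAt T j c ≡ true
    j-turns = cong isArrow (topmost⇒↑ T t)

    j-not-← : alternative T j c ≢ ←
    j-not-← eq with () ← trans (sym (topmost⇒↑ T t)) eq

    no-turn : ∀ {r} → r < j → turnsAt T r c ≢ true
    no-turn r<j turn with turnsAt⇒arrow turn
    ... | inj₁ eq = least _ r<j (proj₁ (↑⇒topmost T eq))
    ... | inj₂ eq with (_ , r′ , r′<r , o′) , _ ← ←⇒rightmost T eq =
      least r′ (<-trans r′<r r<j) o′

    only-← : ∀ {r} → j < r → (turnsAt T r c ≡ true → alternative T r c ≡ ←) ×
                             (alternative T r c ≡ ← → turnsAt T r c ≡ true)
    only-← {r} j<r = to , cong isArrow
      where
      to : turnsAt T r c ≡ true → alternative T r c ≡ ←
      to turn with turnsAt⇒arrow turn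
      ... | inj₁ eq = contradiction o (proj₂ (↑⇒topmost T eq) _ j<r)
      ... | inj₂ eq = eq

  φ-insertColumn : ∀ {P c cs w} → P ʳ++ (c ∷ cs) ≡ columns T → ValidWord T P w → ∀ y →
    φ-function (insertColumn T w c) y ≡ cross c (φ-function w y)
  φ-insertColumn {P} {c} {cs} {w} split valid y
    with j , t@(o , least) ← column-has-↑ T (columns-column T (subst (c ∈_) split (∈-ʳ++ʳ P (here refl))))
    with valid′ ← step-valid T split valid
    -- The fold over the rows marked `↑` becomes a single insertion before `j`, and `cross c`
    -- becomes `cycle (j ∷ block)`.
    rewrite rowsMarked-↑ T t | topmost⇒turning t
    = φ-insertBefore j block (All.tabulate j<) block#w w-unique j∈w y
    where
    open ValidWord valid
    block = rowsMarked T ← c ∷ʳ c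

    cColumn : kind c ≡ column
    cColumn = proj₁ (proj₂ (proj₁ o))

    j< : ∀ {r} → r ∈ block → j < r
    j< {r} r∈ with ∈-++⁻ (rowsMarked T ← c) r∈
    ... | inj₂ (here refl) = proj₂ (proj₂ (proj₁ o))
    -- A restricted zero has a 1 above it in its column; in Row `j` or higher this would contradict
    -- that the 1 of Row `j` is topmost.
    ... | inj₁ r∈′ with (_ , r′ , r′<r , o′) , _ ← ←⇒rightmost T (∈-rowsMarked⁻ T r∈′)
                   with <-cmp j r
    ... | tri< j<r _ _  = j<r
    ... | tri≈ _ refl _ = contradiction o′ (least r′ r′<r)
    ... | tri> _ _ r<j  = contradiction o′ (least r′ (<-trans r′<r r<j))

    c∉w : c ∉ w
    c∉w c∈ with sound c∈
    ... | unrestricted (isRow , _) = row≢column T isRow cColumn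
    ... | restricted _ eq =
      row≢column T (proj₁ (proj₁ (proj₁ (proj₁ (←⇒rightmost T eq))))) cColumn
    ... | column c∈P = <-irrefl refl (All.head (All.lookup
      (proj₂ (ʳ++-sorted⁻ P (subst (AllPairs _) (sym split) (columns-sorted T)))) c∈P))

    -- If `j` were absent, `insertBefore` would leave the word unchanged, but the new word contains
    -- `c` and the old one does not.
    j∈w : j ∈ w
    j∈w with mem? _≟_ j w
    ... | yes j∈ = j∈
    ... | no  j∉ = contradiction
      (subst (c ∈_) (insertBefore-∉ j block j∉) (ValidWord.covers valid′ (column (here refl)))) c∉w

    -- `block ++ w` is a rearrangement of the new word, whose letters are already known to be
    -- distinct.
    block#w : Disjoint block w
    block#w (x∈ , x∈′) = ++-unique-disjoint block
      (SetoidPerm.Unique-resp-↭ (setoid (Fin n))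
        (↭⇒↭ₛ (insertBefore-↭ j block j∈w)) (ValidWord.w-unique valid′)) x∈ x∈′

  sweep : Fin n → List (Fin n) → Fin n
  sweep = foldl (λ x c → cross c x)

  -- Each insertion composes with its cycle on the outside, so the cycles act in the order of
  -- insertion, from the leftmost column to the rightmost.
  φ-insertColumns : ∀ P cs {w} → P ʳ++ cs ≡ columns T → ValidWord T P w → ∀ y →
    φ-function (foldl (insertColumn T) w cs) y ≡ sweep (φ-function w y) cs
  φ-insertColumns P []       split valid y = refl
  φ-insertColumns P (c ∷ cs) split valid y =
    trans (φ-insertColumns (c ∷ P) cs split (step-valid T split valid) y)
          (cong (λ x → sweep x cs) (φ-insertColumn split valid y))

  φ-Φ : ∀ y → φ-function (Φ-letters T) y ≡ sweep y (columns T)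
  φ-Φ y = trans (φ-insertColumns [] (columns T) refl (start-valid T) y)
    (cong (λ x → sweep x (columns T))
      (φ-sorted (AllPairs.filter⁺ unrestrictedRow? (allFin-sorted n)) y))

  -- No cell has a row label as its column, so the cycle is trivial. Hence `sweep` may run over all
  -- labels, as the ranges of `east` and `south` do.
  cross-row : ∀ {c} → kind c ≡ row → ∀ x → cross c x ≡ x
  cross-row {c} isRow x
    rewrite filter-none (turns? c) {xs = allFin n}
              (All.universal (λ r turn → row≢column T isRow (proj₁ (proj₂ (turnsAt⇒cell T {r} turn)))) _)
    = cycle-singleton c x

  cross-no-turn : ∀ {x c} → turnsAt T x c ≢ true → x ≢ c → cross c x ≡ x
  cross-no-turn {x} {c} ¬turn x≢c = cycle-∉ _ λ x∈ → lemma (∈-++⁻ (turning c (allFin n)) x∈)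
    where
    lemma : x ∈ turning c (allFin n) ⊎ x ∈ c ∷ [] → ⊥
    lemma (inj₁ x∈)         = ¬turn (proj₂ (∈-filter⁻ (turns? c) {xs = allFin n} x∈))
    lemma (inj₂ (here x≡c)) = x≢c x≡c

  cross-column : ∀ {x c} → kind x ≡ column → x ≢ c → cross c x ≡ x
  cross-column isColumn = cross-no-turn λ turn → row≢column T (proj₁ (turnsAt⇒cell T turn)) isColumn

  cross-left : ∀ {x c} → kind x ≡ row → ¬ x < c → cross c x ≡ x
  cross-left {x} {c} isRow x≮c with x ≟ c
  -- The cycle of `cross c` always contains `c`, so this case rests on `c` being a row label, which
  -- makes the cycle trivial.
  ... | yes refl = cross-row isRow x
  ... | no  x≢c  = cross-no-turn (λ turn → x≮c (proj₂ (proj₂ (turnsAt⇒cell T turn)))) x≢c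

  -- Zigzag paths

  sweep-fixed : ∀ {x cs} → All (λ c → cross c x ≡ x) cs → sweep x cs ≡ x
  sweep-fixed []                    = refl
  sweep-fixed {cs = c ∷ cs} (p ∷ ps) = trans (cong (λ y → sweep y cs) p) (sweep-fixed ps)

  sweep-columns : ∀ x → sweep x (columns T) ≡ sweep x (reverse (allFin n))
  sweep-columns x = foldl-filter (λ c → kind c ≟ᵏ column) (λ y c → cross c y)
    (λ ¬column → cross-row (isRow ¬column)) x (reverse (allFin n))
    where
    isRow : ∀ {c} → kind c ≢ column → kind c ≡ row
    isRow {c} ≢column with kind c
    ... | row    = refl
    ... | column = contradiction refl ≢column

  head-turning-∷ : ∀ {r c} xs → turnsAt T r c ≡ true → fromMaybe c (head (turning c (r ∷ xs))) ≡ r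
  head-turning-∷ {r} {c} xs turn
    rewrite filter-accept (turns? c) {xs = xs} turn = refl

  turning-∷-no-turn : ∀ {r c} xs → turnsAt T r c ≡ false → turning c (r ∷ xs) ≡ turning c xs
  turning-∷-no-turn {r} {c} xs turn =
    filter-reject (turns? c) (Bool.not-¬ turn)

  -- An arrow of Column `c` lies in a row with a label smaller than `c`.
  turning-from : ∀ {c} b a → b ʳ++ (c ∷ a) ≡ allFin n → turning c (c ∷ a) ≡ []
  turning-from {c} b a split = filter-none (turns? c)
    ((λ turn → <-irrefl refl (proj₂ (proj₂ (turnsAt⇒cell T {c} turn)))) ∷
     All.map (λ {x} c<x turn → <-asym c<x (proj₂ (proj₂ (turnsAt⇒cell T {x} turn))))
       (subst (All (c <_)) (above-split b a split) (All.all-filter (c <?_) (allFin n))))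

  -- A path that turns south in Row `r` turns east again at the next arrow below, or reaches the
  -- bottom, represented by `c`. Labels before `r` only contribute letters in front of `r` in the
  -- cycle, and labels from `c` on contribute none.
  cross-turn : ∀ b {r} xs {c} a → b ʳ++ (r ∷ xs ++ c ∷ a) ≡ allFin n → turnsAt T r c ≡ true →
    cross c r ≡ fromMaybe c (head (turning c xs))
  cross-turn b {r} xs {c} a split turn = begin
    cycle (turning c (allFin n) ∷ʳ c) r ≡⟨ cong (λ l → cycle (l ∷ʳ c) r) arrows ⟩
    cycle ((turning c (reverse b) ++ r ∷ turning c xs) ∷ʳ c) r
      ≡⟨ cycle-next (turning c (reverse b)) (turning c xs) c r∉ ⟩
    fromMaybe c (head (turning c xs))   ∎
    where
    open ≡-Reasoning
    r∉ : r ∉ turning c (reverse b)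
    r∉ r∈ = <-irrefl refl (All.lookup
      (subst (All (_< r)) (below-split b (xs ++ c ∷ a) split) (All.all-filter (_<? r) (allFin n)))
      (proj₁ (∈-filter⁻ (turns? c) r∈)))

    arrows : turning c (allFin n) ≡ turning c (reverse b) ++ r ∷ turning c xs
    arrows = begin
      turning c (allFin n)
        ≡⟨ cong (turning c) (trans (sym (ʳ++-defn b)) split) ⟨
      turning c (reverse b ++ r ∷ xs ++ c ∷ a)
        ≡⟨ filter-++ (turns? c) (reverse b) (r ∷ xs ++ c ∷ a) ⟩
      turning c (reverse b) ++ turning c (r ∷ xs ++ c ∷ a)
        ≡⟨ cong (turning c (reverse b) ++_) (filter-accept (turns? c) turn) ⟩
      turning c (reverse b) ++ r ∷ turning c (xs ++ c ∷ a)
        ≡⟨ cong (λ l → turning c (reverse b) ++ r ∷ l) (filter-++ (turns? c) xs (c ∷ a)) ⟩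
      turning c (reverse b) ++ r ∷ turning c xs ++ turning c (c ∷ a)
        ≡⟨ cong (λ l → turning c (reverse b) ++ r ∷ turning c xs ++ l)
             (turning-from (xs ʳ++ r ∷ b) a (trans (ʳ++-ʳ++ xs) split)) ⟩
      turning c (reverse b) ++ r ∷ turning c xs ++ []
        ≡⟨ cong (λ l → turning c (reverse b) ++ r ∷ l) (++-identityʳ (turning c xs)) ⟩
      turning c (reverse b) ++ r ∷ turning c xs ∎

  -- A path entering from the top starts at the last letter of the cycle and wraps around to the
  -- first arrow.
  cross-self : ∀ c → cross c c ≡ fromMaybe c (head (turning c (below c)))
  cross-self c = begin
    cycle (turning c (allFin n) ∷ʳ c) c ≡⟨ cong (λ l → cycle (l ∷ʳ c) c) arrows ⟩
    cycle (turning c (below c) ∷ʳ c) c  ≡⟨ cycle-of-last (turning c (below c)) c c∉ ⟩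
    fromMaybe c (head (turning c (below c))) ∎
    where
    open ≡-Reasoning
    c∉ : c ∉ turning c (below c)
    c∉ c∈ = <-irrefl refl (proj₂ (∈-filter⁻ (_<? c) {xs = allFin n} (proj₁ (∈-filter⁻ (turns? c) c∈))))

    arrows : turning c (allFin n) ≡ turning c (below c)
    arrows = begin
      turning c (allFin n)                   ≡⟨ cong (turning c) (labels-split c) ⟨
      turning c (below c ++ c ∷ above c)     ≡⟨ filter-++ (turns? c) (below c) (c ∷ above c) ⟩
      turning c (below c) ++ turning c (c ∷ above c)
        ≡⟨ cong (turning c (below c) ++_)
             (turning-from (reverse (below c)) (above c) (split-at c)) ⟩
      turning c (below c) ++ []              ≡⟨ ++-identityʳ (turning c (below c)) ⟩
      turning c (below c)                    ∎

  -- By induction on the range `xs`, together with `south-sweep`; `b` lists the labels before `r`,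
  -- nearest first. Heading east, the path meets the end of the range first, which is also the next
  -- label swept. Once the range is exhausted the path has ended, and sweeping `r` and `b` changes
  -- nothing.
  east-sweep : ∀ {d r} b (xs : Vec (Fin n) d) a → kind r ≡ row →
    b ʳ++ (r ∷ Vec.toList xs ++ a) ≡ allFin n → east T r xs ≡ sweep r (Vec.toList xs ʳ++ r ∷ b)
  -- Column `c` counts as already crossed, so the sweep starts where the path will leave it: at the
  -- row of the next arrow, or at `c` if the path reaches the bottom.
  south-sweep : ∀ {d c} b (xs : Vec (Fin n) d) a → kind c ≡ column →
    b ʳ++ (Vec.toList xs ++ c ∷ a) ≡ allFin n →
    south T c xs ≡ sweep (fromMaybe c (head (turning c (Vec.toList xs)))) (Vec.toList xs ʳ++ b)

  -- The path is at the right end of Row `r`, and no column with a label up to `r` has a cell in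
  -- that row.
  east-sweep {r = r} b [] a isRow split = sym (sweep-fixed {r} {r ∷ b}
    (cross-row isRow r ∷ All.tabulate λ {k} k∈ → cross-left isRow λ r<k →
      <-asym r<k (All.lookup b<r (Any.reverse⁺ k∈))))
    where
    b<r : All (_< r) (reverse b)
    b<r = subst (All (_< r)) (below-split b a split) (All.all-filter (_<? r) (allFin n))
  east-sweep {r = r} b xs@(_ ∷ _) a isRow split = trans (step refl)
    (cong (sweep r) (sym snoc))
    where
    c = last xs
    rest = Vec.toList (init xs)

    -- The last label of the range is the first one swept, so the sweep begins with `cross c r`.
    snoc : Vec.toList xs ʳ++ r ∷ b ≡ c ∷ (rest ʳ++ r ∷ b)
    snoc = trans (cong (_ʳ++ r ∷ b) (trans (sym (++-identityʳ _)) (sym (toList-init-last xs []))))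
                 (++-ʳ++ rest)

    split′ : b ʳ++ (r ∷ rest ++ c ∷ a) ≡ allFin n
    split′ = trans (cong (λ l → b ʳ++ (r ∷ l)) (toList-init-last xs a)) split

    step : ∀ {t} → turnsAt T r c ≡ t → east T r xs ≡ sweep (cross c r) (rest ʳ++ r ∷ b)
    step {true} turn = begin
      east T r xs       ≡⟨ cong (if_then south T c (init xs) else east T r (init xs)) turn ⟩
      south T c (init xs)
        ≡⟨ south-sweep (r ∷ b) (init xs) a (proj₁ (proj₂ (turnsAt⇒cell T turn))) split′ ⟩
      sweep (fromMaybe c (head (turning c rest))) (rest ʳ++ r ∷ b)
        ≡⟨ cong (λ x → sweep x (rest ʳ++ r ∷ b)) (cross-turn b rest a split′ turn) ⟨
      sweep (cross c r) (rest ʳ++ r ∷ b) ∎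
      where open ≡-Reasoning
    step {false} turn = begin
      east T r xs       ≡⟨ cong (if_then south T c (init xs) else east T r (init xs)) turn ⟩
      east T r (init xs) ≡⟨ east-sweep b (init xs) (c ∷ a) isRow split′ ⟩
      sweep r (rest ʳ++ r ∷ b)
        ≡⟨ cong (λ x → sweep x (rest ʳ++ r ∷ b)) (cross-no-turn (Bool.not-¬ turn) r≢c) ⟨
      sweep (cross c r) (rest ʳ++ r ∷ b) ∎
      where
      open ≡-Reasoning
      r≢c : r ≢ c
      r≢c r≡c = <-irrefl r≡c (All.lookup
        (subst (All (r <_)) (above-split b (rest ++ c ∷ a) split′) (All.all-filter (r <?_) (allFin n)))
        (∈-++⁺ʳ rest (here refl)))

  -- The path is at the bottom of Column `c`. The cycle of any other label consists of that label
  -- and of rows, so it fixes `c`.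
  south-sweep {c = c} b [] a isColumn split = sym (sweep-fixed {c} {b}
    (All.tabulate λ {k} k∈ → cross-column isColumn λ c≡k →
      <-irrefl (sym c≡k) (All.lookup b<c (Any.reverse⁺ k∈))))
    where
    b<c : All (_< c) (reverse b)
    b<c = subst (All (_< c)) (below-split b a split) (All.all-filter (_<? c) (allFin n))
  south-sweep {c = c} b (r ∷ xs) a isColumn split = step refl
    where
    rest = Vec.toList xs
    step : ∀ {t} → turnsAt T r c ≡ t →
      south T c (r ∷ xs) ≡ sweep (fromMaybe c (head (turning c (r ∷ rest)))) (rest ʳ++ r ∷ b)
    step {true} turn = begin
      south T c (r ∷ xs) ≡⟨ cong (if_then east T r xs else south T c xs) turn ⟩
      east T r xs        ≡⟨ east-sweep b xs (c ∷ a) (proj₁ (turnsAt⇒cell T turn)) split ⟩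
      sweep r (rest ʳ++ r ∷ b)
        ≡⟨ cong (λ x → sweep x (rest ʳ++ r ∷ b)) (head-turning-∷ rest turn) ⟨
      sweep (fromMaybe c (head (turning c (r ∷ rest)))) (rest ʳ++ r ∷ b) ∎
      where open ≡-Reasoning
    step {false} turn = begin
      south T c (r ∷ xs) ≡⟨ cong (if_then east T r xs else south T c xs) turn ⟩
      south T c xs       ≡⟨ south-sweep (r ∷ b) xs a isColumn split ⟩
      sweep (fromMaybe c (head (turning c rest))) (rest ʳ++ r ∷ b)
        ≡⟨ cong (λ l → sweep (fromMaybe c (head l)) (rest ʳ++ r ∷ b)) (turning-∷-no-turn rest turn) ⟨
      sweep (fromMaybe c (head (turning c (r ∷ rest)))) (rest ʳ++ r ∷ b) ∎
      where open ≡-Reasoning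

  -- A path entering Row `i` has all larger labels as its range, so `east-sweep` covers the full
  -- sweep. For a path entering Column `i`, the larger labels are swept first and fix `i`; then
  -- `cross-self` gives the first turn, and `south-sweep` the rest.
  ζ-sweep : ∀ i → ζ-function T i ≡ sweep i (reverse (allFin n))
  ζ-sweep i with kind i in k
  ... | row = begin
    east T i (Vec.fromList (above i))
      ≡⟨ east-sweep (reverse (below i)) (Vec.fromList (above i)) [] k split ⟩
    sweep i (Vec.toList (Vec.fromList (above i)) ʳ++ i ∷ reverse (below i))
      ≡⟨ cong (λ l → sweep i (l ʳ++ i ∷ reverse (below i))) (Vec.toList∘fromList (above i)) ⟩
    sweep i (above i ʳ++ i ∷ reverse (below i)) ≡⟨ cong (sweep i) (reverse-split i) ⟩
    sweep i (reverse (allFin n)) ∎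
    where
    open ≡-Reasoning
    split : reverse (below i) ʳ++ (i ∷ Vec.toList (Vec.fromList (above i)) ++ []) ≡ allFin n
    split rewrite Vec.toList∘fromList (above i) | ++-identityʳ (above i) = split-at i
  ... | column = begin
    south T i (Vec.fromList (below i))
      ≡⟨ south-sweep [] (Vec.fromList (below i)) (above i) k split ⟩
    sweep (fromMaybe i (head (turning i (Vec.toList (Vec.fromList (below i))))))
          (reverse (Vec.toList (Vec.fromList (below i))))
      ≡⟨ cong (λ l → sweep (fromMaybe i (head (turning i l))) (reverse l))
              (Vec.toList∘fromList (below i)) ⟩
    sweep (fromMaybe i (head (turning i (below i)))) (reverse (below i))
      ≡⟨ cong (λ x → sweep x (reverse (below i))) (cross-self i) ⟨
    sweep i (i ∷ reverse (below i))
      ≡⟨ cong (λ x → sweep x (i ∷ reverse (below i))) (sweep-fixed {i} {reverse (above i)}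
           (All.tabulate λ {c} c∈ → cross-column k λ i≡c → <-irrefl i≡c
             (proj₂ (∈-filter⁻ (i <?_) {xs = allFin n} (Any.reverse⁻ c∈))))) ⟨
    sweep (sweep i (reverse (above i))) (i ∷ reverse (below i))
      ≡⟨ foldl-++ (λ x c → cross c x) i (reverse (above i)) (i ∷ reverse (below i)) ⟨
    sweep i (reverse (above i) ++ i ∷ reverse (below i))
      ≡⟨ cong (sweep i) (ʳ++-defn (above i)) ⟨
    sweep i (above i ʳ++ i ∷ reverse (below i)) ≡⟨ cong (sweep i) (reverse-split i) ⟩
    sweep i (reverse (allFin n)) ∎
    where
    open ≡-Reasoning
    split : Vec.toList (Vec.fromList (below i)) ++ i ∷ above i ≡ allFin n
    split rewrite Vec.toList∘fromList (below i) = labels-split i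

theorem5p1 : (n : ℕ) → n ≥ 1 → (T : PT n) → ζᵃˡᵗ T ≈ φ (Φ T)
theorem5p1 n _ T i = begin
  ζ-function T i                  ≡⟨ ζ-sweep T i ⟩
  sweep T i (reverse (allFin n))  ≡⟨ sweep-columns T i ⟨
  sweep T i (columns T)           ≡⟨ φ-Φ T i ⟨
  φ-function (Φ-letters T) i      ∎
  where open ≡-Reasoning
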